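{- One has the disjoint union $\mathcal{P}_5=\mathcal{P}_{5,1}\sqcup\mathcal{P}_{5,3}$, and $$\mathcal{P}_5=\{s_3x^3+s_2x^2+s_1x+s_0\colon s_0,s_1,s_2,s_3\in\mathbb{F}_5,\ (s_1+s_3)^4=1,\ s_2^2=3s_1s_3\},$$ with $$\mathcal{P}_{5,1}=\{s_1x+s_0\colon s_0,s_1\in\mathbb{F}_5,\ s_1^4=1\}$$ and $$\mathcal{P}_{5,3}=\{s_3x^3+s_2x^2+s_1x+s_0\colon s_0,s_1,s_2,s_3\in\mathbb{F}_5,\ s_3^4=1,\ s_2^2=3s_1s_3\}.$$
   Context: $\mathbb{F}_5$ is the field with five elements. $\mathcal{P}_5$ is the set of polynomials in $\mathbb{F}_5[x]$ of degree less than $5$ that act as permutations of $\mathbb{F}_5$, and $\mathcal{P}_{5,d}$ is the subset of those of degree $d$. -}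

module Defs where

open import Algebra.Apartness.Bundles using (HeytingField)
open import Algebra.Bundles using (CommutativeRing; Semiring)
import Algebra.Definitions.RawSemiring as RawSemiringDefinitions
open import Algebra.Structures using (IsCommutativeRing)
open import Data.Fin using (Fin; toℕ; #_)
open import Data.Fin.Properties using (_≟_; all?; any?)
open import Data.List.Base using (List; []; _∷_)
open import Data.Nat.Base as ℕ using (ℕ; zero; suc)
open import Data.Nat.DivMod using (_mod_)
open import Data.Product.Base using (_×_; _,_; ∃)
open import Data.Sum.Base using (inj₁; inj₂)
open import Function.Definitions using (Bijective)
open import Level using (0ℓ)
open import Relation.Binary.Construct.Add.Infimum.Strict ℕ._<_ using (_<₋_)
open import Relation.Binary.PropositionalEquality
  using (_≡_; _≢_; refl; sym; trans; cong; cong₂; isEquivalence)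
open import Relation.Nullary using (yes; no; ¬?)
open import Relation.Nullary.Construct.Add.Infimum using (_₋; ⊥₋; [_])
open import Relation.Nullary.Decidable using (toWitness; decidable-stable; _→-dec_)
open import Relation.Unary using (Pred; _∩_)

𝔽₅ : Set
𝔽₅ = Fin 5

infixl 6 _+_
infixl 7 _*_
infix  8 -_

_+_ : 𝔽₅ → 𝔽₅ → 𝔽₅
a + b = (toℕ a ℕ.+ toℕ b) mod 5

_*_ : 𝔽₅ → 𝔽₅ → 𝔽₅
a * b = (toℕ a ℕ.* toℕ b) mod 5

-_ : 𝔽₅ → 𝔽₅
- a = (5 ℕ.∸ toℕ a) mod 5

+-assoc : ∀ a b c → (a + b) + c ≡ a + (b + c)
+-assoc = toWitness {a? = all? λ a → all? λ b → all? λ c → (a + b) + c ≟ a + (b + c)} _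

+-comm : ∀ a b → a + b ≡ b + a
+-comm = toWitness {a? = all? λ a → all? λ b → a + b ≟ b + a} _

+-identityˡ : ∀ a → # 0 + a ≡ a
+-identityˡ = toWitness {a? = all? λ a → # 0 + a ≟ a} _

+-inverseˡ : ∀ a → (- a) + a ≡ # 0
+-inverseˡ = toWitness {a? = all? λ a → (- a) + a ≟ # 0} _

*-assoc : ∀ a b c → (a * b) * c ≡ a * (b * c)
*-assoc = toWitness {a? = all? λ a → all? λ b → all? λ c → (a * b) * c ≟ a * (b * c)} _

*-comm : ∀ a b → a * b ≡ b * a
*-comm = toWitness {a? = all? λ a → all? λ b → a * b ≟ b * a} _

*-identityˡ : ∀ a → # 1 * a ≡ a
*-identityˡ = toWitness {a? = all? λ a → # 1 * a ≟ a} _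

*-distribˡ-+ : ∀ a b c → a * (b + c) ≡ a * b + a * c
*-distribˡ-+ =
  toWitness {a? = all? λ a → all? λ b → all? λ c → a * (b + c) ≟ a * b + a * c} _

≢⇒invertible : ∀ a b → a ≢ b → ∃ λ c → c * (a + (- b)) ≡ # 1
≢⇒invertible = toWitness
  {a? = all? λ a → all? λ b → ¬? (a ≟ b) →-dec any? λ c → c * (a + (- b)) ≟ # 1} _

invertible⇒≢ : ∀ a b c → c * (a + (- b)) ≡ # 1 → a ≢ b
invertible⇒≢ = toWitness
  {a? = all? λ a → all? λ b → all? λ c → (c * (a + (- b)) ≟ # 1) →-dec ¬? (a ≟ b)} _

isCommutativeRing : IsCommutativeRing _≡_ _+_ _*_ -_ (# 0) (# 1)
isCommutativeRing = record
  { isRing = record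
    { +-isAbelianGroup = record
      { isGroup = record
        { isMonoid = record
          { isSemigroup = record
            { isMagma = record { isEquivalence = isEquivalence ; ∙-cong = cong₂ _+_ }
            ; assoc   = +-assoc
            }
          ; identity = +-identityˡ , λ a → trans (+-comm a (# 0)) (+-identityˡ a)
          }
        ; inverse = +-inverseˡ , λ a → trans (+-comm a (- a)) (+-inverseˡ a)
        ; ⁻¹-cong = cong -_
        }
      ; comm = +-comm
      }
    ; *-cong     = cong₂ _*_
    ; *-assoc    = *-assoc
    ; *-identity = *-identityˡ , λ a → trans (*-comm a (# 1)) (*-identityˡ a)
    ; distrib    = *-distribˡ-+ , λ a b c →
        trans (*-comm (b + c) a)
          (trans (*-distribˡ-+ a b c) (cong₂ _+_ (*-comm a b) (*-comm a c)))
    }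
  ; *-comm = *-comm
  }

𝔽₅-commutativeRing : CommutativeRing 0ℓ 0ℓ
𝔽₅-commutativeRing = record { isCommutativeRing = isCommutativeRing }

𝔽₅-field : HeytingField 0ℓ 0ℓ 0ℓ
𝔽₅-field = record
  { Carrier = 𝔽₅
  ; _≈_     = _≡_
  ; _#_     = _≢_
  ; _+_     = _+_
  ; _*_     = _*_
  ; -_      = -_
  ; 0#      = # 0
  ; 1#      = # 1
  ; isHeytingField = record
    { isHeytingCommutativeRing = record
      { isCommutativeRing   = isCommutativeRing
      ; isApartnessRelation = record
        { irrefl  = λ a≡b a≢b → a≢b a≡b
        ; sym     = λ a≢b b≡a → a≢b (sym b≡a)
        ; cotrans = cotrans
        }
      ; #⇒invertible = λ {a} {b} a≢b →
          let (c , eq) = ≢⇒invertible a b a≢b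
          in c , eq , trans (*-comm (a + (- b)) c) eq
      ; invertible⇒# = λ {a} {b} (c , eq , _) → invertible⇒≢ a b c eq
      }
    ; tight = λ a b → decidable-stable (a ≟ b) , λ a≡b a≢b → a≢b a≡b
    }
  }
  where
  cotrans : ∀ {a b : 𝔽₅} → a ≢ b → ∀ c → _
  cotrans {a} {b} a≢b c with a ≟ c
  ... | yes a≡c = inj₂ λ c≡b → a≢b (trans a≡c c≡b)
  ... | no  a≢c = inj₁ a≢c

open RawSemiringDefinitions
  (Semiring.rawSemiring (CommutativeRing.semiring 𝔽₅-commutativeRing)) public using (_^_)

-- The list s₀ ∷ s₁ ∷ … ∷ sₙ ∷ [] is the polynomial s₀ + s₁ x + … + sₙ xⁿ of
-- 𝔽₅[x].  Trailing zeros are allowed, so equality of polynomials is _≈_ rather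
-- than equality of lists.
Poly : Set
Poly = List 𝔽₅

coeff : Poly → ℕ → 𝔽₅
coeff []      _       = # 0
coeff (s ∷ p) zero    = s
coeff (s ∷ p) (suc k) = coeff p k

infix 4 _≈_

_≈_ : Poly → Poly → Set
p ≈ q = ∀ k → coeff p k ≡ coeff q k

⟦_⟧ : Poly → 𝔽₅ → 𝔽₅
⟦ []    ⟧ a = # 0
⟦ s ∷ p ⟧ a = s + a * ⟦ p ⟧ a

-- The zero polynomial has degree ⊥₋, that is, -∞.
degree : Poly → ℕ ₋
degree []      = ⊥₋
degree (s ∷ p) with degree p
... | [ d ] = [ suc d ]
... | ⊥₋ with s ≟ # 0
...   | yes _ = ⊥₋
...   | no  _ = [ 0 ]

𝒫₅ : Pred Poly 0ℓ
𝒫₅ p = degree p <₋ [ 5 ] × Bijective _≡_ _≡_ ⟦ p ⟧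

𝒫₅,_ : ℕ → Pred Poly 0ℓ
𝒫₅, d = 𝒫₅ ∩ λ p → degree p ≡ [ d ]

{-# OPTIONS --safe #-}

-- Degree and values of a polynomial depend only on its coefficients, and a polynomial of
-- degree < 5 has at most five nonzero ones, so which polynomials are permutations is
-- settled by running through the coefficient tuples. If s₃ = 0, the two equations say
-- s₂ = 0 and s₁ ≠ 0; if s₃ ≠ 0, the first follows from the second, because s₁ = - s₃ would
-- make s₂² / s₃² equal to the nonresidue 2.
module Submission where

open import Data.Fin using (#_)
open import Data.Fin.Properties using (_≟_; all?; any?)
open import Data.List.Base using ([]; _∷_; applyUpTo; length)
open import Data.Nat.Base as ℕ using (ℕ; zero; suc; z≤n; s≤s; z<s)
import Data.Nat.Properties as ℕ
open import Data.Product.Base using (_×_; _,_; proj₁; proj₂; ∃-syntax)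
open import Data.Sum.Base as Sum using (_⊎_; inj₁; inj₂)
open import Function.Base using (_∘_)
open import Function.Consequences.Propositional
  using (strictlySurjective⇒surjective; surjective⇒strictlySurjective)
open import Function.Definitions using (Bijective)
open import Relation.Binary.Construct.Add.Infimum.Strict ℕ._<_
  using (_<₋_; ⊥₋<[_]; [_]; <₋-trans)
open import Relation.Binary.PropositionalEquality
  using (_≡_; _≢_; _≗_; refl; sym; trans; cong₂; subst; subst₂)
open import Relation.Nullary using (Dec; yes; no; contradiction)
open import Relation.Nullary.Construct.Add.Infimum using (⊥₋; [_])
open import Relation.Nullary.Decidable
  using (toWitness; map′; _→-dec_; _×-dec_; _⊎-dec_)
open import Relation.Unary using (_≐_; _∪_; _⊥_)
open import Defs

-- `p ≈ q` unfolds to a statement about `coeff`, from which the lists cannot be inferred; hence the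
-- explicit arguments here and below.
≈-sym : ∀ p q → p ≈ q → q ≈ p
≈-sym p q p≈q k = sym (p≈q k)

≈-trans : ∀ p q r → p ≈ q → q ≈ r → p ≈ r
≈-trans p q r p≈q q≈r k = trans (p≈q k) (q≈r k)

degree-∷-cong : ∀ {s t} p q → s ≡ t → degree p ≡ degree q → degree (s ∷ p) ≡ degree (t ∷ q)
degree-∷-cong p q refl eq with degree p | degree q | eq
... | [ _ ] | _ | refl = refl
... | ⊥₋    | _ | refl = refl

degree-cong : ∀ p q → p ≈ q → degree p ≡ degree q
degree-cong []      []      p≈q = refl
-- `degree (# 0 ∷ [])` reduces to `⊥₋`, so `[]` can be read as `# 0 ∷ []`, with tail `[]` again.
degree-cong []      (t ∷ q) p≈q = degree-∷-cong [] q (p≈q 0) (degree-cong [] q (p≈q ∘ suc))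
degree-cong (s ∷ p) []      p≈q = degree-∷-cong p [] (p≈q 0) (degree-cong p [] (p≈q ∘ suc))
degree-cong (s ∷ p) (t ∷ q) p≈q = degree-∷-cong p q (p≈q 0) (degree-cong p q (p≈q ∘ suc))

-- The same reading of `[]` for values: `a * # 0` does not reduce for a variable `a`, so it takes a
-- check over all `a`.
⟦0∷[]⟧ : ∀ a → ⟦ # 0 ∷ [] ⟧ a ≡ # 0
⟦0∷[]⟧ = toWitness {a? = all? λ a → ⟦ # 0 ∷ [] ⟧ a ≟ # 0} _

⟦⟧-cong : ∀ p q → p ≈ q → ⟦ p ⟧ ≗ ⟦ q ⟧
⟦⟧-cong []      []      p≈q a = refl
⟦⟧-cong []      (t ∷ q) p≈q a = trans (sym (⟦0∷[]⟧ a))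
  (cong₂ (λ s v → s + a * v) (p≈q 0) (⟦⟧-cong [] q (p≈q ∘ suc) a))
⟦⟧-cong (s ∷ p) []      p≈q a = trans
  (cong₂ (λ s v → s + a * v) (p≈q 0) (⟦⟧-cong p [] (p≈q ∘ suc) a)) (⟦0∷[]⟧ a)
⟦⟧-cong (s ∷ p) (t ∷ q) p≈q a =
  cong₂ (λ s v → s + a * v) (p≈q 0) (⟦⟧-cong p q (p≈q ∘ suc) a)

bijective-cong : ∀ {a b} {A : Set a} {B : Set b} {f g : A → B} →
  f ≗ g → Bijective _≡_ _≡_ f → Bijective _≡_ _≡_ g
bijective-cong f≗g (injective , surjective) =
  (λ {x} {y} gx≡gy → injective (trans (f≗g x) (trans gx≡gy (sym (f≗g y))))) ,
  λ y → let (x , fx≡y) = surjective y in x , λ {z} z≡x → trans (sym (f≗g z)) (fx≡y z≡x)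

𝒫₅-resp-≈ : ∀ p q → p ≈ q → 𝒫₅ p → 𝒫₅ q
𝒫₅-resp-≈ p q p≈q (deg<5 , bijective) =
  subst (_<₋ [ 5 ]) (degree-cong p q p≈q) deg<5 , bijective-cong (⟦⟧-cong p q p≈q) bijective

degree-∷ : ∀ {d} s p → degree p ≡ [ d ] → degree (s ∷ p) ≡ [ suc d ]
degree-∷ s p eq with degree p | eq
... | _ | refl = refl

degree-constant : ∀ s → s ≢ # 0 → degree (s ∷ []) ≡ [ 0 ]
degree-constant s s≢0 with s ≟ # 0
... | yes s≡0 = contradiction s≡0 s≢0
... | no  _   = refl

-- Trailing zeros only lower the degree, so this bound covers a coefficient tuple whose last entry
-- may vanish.
degree<length : ∀ p → degree p <₋ [ length p ]
degree<length []      = ⊥₋<[ 0 ]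
degree<length (s ∷ p) with degree p | degree<length p
... | [ d ] | [ d<n ] = [ s≤s d<n ]
... | ⊥₋    | _ with s ≟ # 0
...   | yes _ = ⊥₋<[ _ ]
...   | no  _ = [ z<s ]

degree<⇒coeff≡0 : ∀ p n → degree p <₋ [ n ] → ∀ k → n ℕ.≤ k → coeff p k ≡ # 0
degree<⇒coeff≡0 [] _ _ _ _ = refl
degree<⇒coeff≡0 (s ∷ p) n deg<n k n≤k with degree p | degree<⇒coeff≡0 p
degree<⇒coeff≡0 (s ∷ p) (suc n) [ s≤s d<n ] (suc k) (s≤s n≤k) | [ d ] | ih = ih n [ d<n ] k n≤k
degree<⇒coeff≡0 (s ∷ p) n deg<n k n≤k | ⊥₋ | ih with s ≟ # 0
degree<⇒coeff≡0 (s ∷ p) n deg<n zero n≤k | ⊥₋ | ih | yes s≡0 = s≡0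
-- A tail of degree `⊥₋` lies below the bound 0, which makes all its coefficients vanish.
degree<⇒coeff≡0 (s ∷ p) n deg<n (suc k) n≤k | ⊥₋ | ih | yes _ = ih 0 ⊥₋<[ 0 ] k z≤n
degree<⇒coeff≡0 (s ∷ p) n [ z<s ] (suc k) n≤k | ⊥₋ | ih | no _ = ih 0 ⊥₋<[ 0 ] k z≤n

-- Replaces a polynomial by a list of fixed length, the form that the finite searches can handle. A
-- coefficient function `f` can be shifted in the induction.
coeff-applyUpTo : ∀ f n → (∀ k → n ℕ.≤ k → f k ≡ # 0) → ∀ k → f k ≡ coeff (applyUpTo f n) k
coeff-applyUpTo f zero    vanish k       = vanish k z≤n
coeff-applyUpTo f (suc n) vanish zero    = refl
coeff-applyUpTo f (suc n) vanish (suc k) =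
  coeff-applyUpTo (f ∘ suc) n (λ j n≤j → vanish (suc j) (s≤s n≤j)) k

bijective? : (f : 𝔽₅ → 𝔽₅) → Dec (Bijective _≡_ _≡_ f)
bijective? f = map′
  (λ (inj , surj) → (λ {a} {b} → inj a b) , strictlySurjective⇒surjective surj)
  (λ (inj , surj) → (λ a b → inj {a} {b}) , surjective⇒strictlySurjective surj)
  ((all? λ a → all? λ b → (f a ≟ f b) →-dec (a ≟ b)) ×-dec
   (all? λ b → any? λ a → f a ≟ b))

Condition : 𝔽₅ → 𝔽₅ → 𝔽₅ → Set
Condition s₁ s₂ s₃ = ((s₁ + s₃) ^ 4 ≡ # 1) × (s₂ ^ 2 ≡ # 3 * s₁ * s₃)

condition? : ∀ s₁ s₂ s₃ → Dec (Condition s₁ s₂ s₃)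
condition? s₁ s₂ s₃ = ((s₁ + s₃) ^ 4 ≟ # 1) ×-dec (s₂ ^ 2 ≟ # 3 * s₁ * s₃)

-- Decided over all 3125 tuples. Behind it are power sums, as in Hermite's criterion: for
-- `0 ≤ k < 8` the sum of `a ^ k` over the field is -1 if `k = 4` and 0 otherwise. The values of a
-- permutation and their squares both sum to 0. The first sum is `- s₄`; given `s₄ = 0`, the second
-- is minus `s₂² + 2 s₁ s₃`, and -2 = 3. If `s₁ = - s₃`, then `s₂² = 2 s₃²` with 2 a nonresidue, so
-- the polynomial would be constant.
bijective⇒condition : ∀ s₀ s₁ s₂ s₃ s₄ →
  Bijective _≡_ _≡_ ⟦ s₀ ∷ s₁ ∷ s₂ ∷ s₃ ∷ s₄ ∷ [] ⟧ → (s₄ ≡ # 0) × Condition s₁ s₂ s₃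
bijective⇒condition = toWitness
  {a? = all? λ s₀ → all? λ s₁ → all? λ s₂ → all? λ s₃ → all? λ s₄ →
    bijective? ⟦ s₀ ∷ s₁ ∷ s₂ ∷ s₃ ∷ s₄ ∷ [] ⟧ →-dec
    ((s₄ ≟ # 0) ×-dec condition? s₁ s₂ s₃)} _

-- For `s₃ ≠ 0`, the second equation lets the cube be completed: the polynomial is `s₃ (x + c)³`
-- plus a constant, with `c = s₂ / (3 s₃)`. Cubing permutes the field because 3 is prime to 4. For
-- `s₃ = 0` the polynomial is linear with nonzero slope.
condition⇒bijective : ∀ s₀ s₁ s₂ s₃ → Condition s₁ s₂ s₃ →
  Bijective _≡_ _≡_ ⟦ s₀ ∷ s₁ ∷ s₂ ∷ s₃ ∷ [] ⟧
condition⇒bijective = toWitness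
  {a? = all? λ s₀ → all? λ s₁ → all? λ s₂ → all? λ s₃ →
    condition? s₁ s₂ s₃ →-dec bijective? ⟦ s₀ ∷ s₁ ∷ s₂ ∷ s₃ ∷ [] ⟧} _

-- By Fermat, a fourth power equal to 1 means nonzero, so the alternatives are `s₃ = 0` and
-- `s₃ ≠ 0`.
condition⇒linear⊎cubic : ∀ s₁ s₂ s₃ → Condition s₁ s₂ s₃ →
  ((s₃ ≡ # 0) × (s₂ ≡ # 0) × (s₁ ^ 4 ≡ # 1)) ⊎ (s₃ ^ 4 ≡ # 1)
condition⇒linear⊎cubic = toWitness
  {a? = all? λ s₁ → all? λ s₂ → all? λ s₃ → condition? s₁ s₂ s₃ →-dec
    (((s₃ ≟ # 0) ×-dec (s₂ ≟ # 0) ×-dec (s₁ ^ 4 ≟ # 1)) ⊎-dec (s₃ ^ 4 ≟ # 1))} _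

linear⇒condition : ∀ s₁ → s₁ ^ 4 ≡ # 1 → Condition s₁ (# 0) (# 0)
linear⇒condition = toWitness
  {a? = all? λ s₁ → (s₁ ^ 4 ≟ # 1) →-dec condition? s₁ (# 0) (# 0)} _

cubic⇒condition : ∀ s₁ s₂ s₃ →
  s₃ ^ 4 ≡ # 1 → s₂ ^ 2 ≡ # 3 * s₁ * s₃ → Condition s₁ s₂ s₃
cubic⇒condition = toWitness
  {a? = all? λ s₁ → all? λ s₂ → all? λ s₃ →
    (s₃ ^ 4 ≟ # 1) →-dec ((s₂ ^ 2 ≟ # 3 * s₁ * s₃) →-dec condition? s₁ s₂ s₃)} _

s⁴≡1⇒s≢0 : ∀ s → s ^ 4 ≡ # 1 → s ≢ # 0
s⁴≡1⇒s≢0 _ () refl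

degree-linear : ∀ s₀ s₁ → s₁ ^ 4 ≡ # 1 → degree (s₀ ∷ s₁ ∷ []) ≡ [ 1 ]
degree-linear s₀ s₁ s₁⁴≡1 =
  degree-∷ s₀ (s₁ ∷ []) (degree-constant s₁ (s⁴≡1⇒s≢0 s₁ s₁⁴≡1))

degree-cubic : ∀ s₀ s₁ s₂ s₃ → s₃ ^ 4 ≡ # 1 → degree (s₀ ∷ s₁ ∷ s₂ ∷ s₃ ∷ []) ≡ [ 3 ]
degree-cubic s₀ s₁ s₂ s₃ s₃⁴≡1 =
  degree-∷ s₀ (s₁ ∷ s₂ ∷ s₃ ∷ []) (degree-∷ s₁ (s₂ ∷ s₃ ∷ []) (degree-linear s₂ s₃ s₃⁴≡1))

linear≈cubic : ∀ s₀ s₁ → s₀ ∷ s₁ ∷ [] ≈ s₀ ∷ s₁ ∷ # 0 ∷ # 0 ∷ []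
linear≈cubic s₀ s₁ 0                         = refl
linear≈cubic s₀ s₁ 1                         = refl
linear≈cubic s₀ s₁ 2                         = refl
linear≈cubic s₀ s₁ 3                         = refl
linear≈cubic s₀ s₁ (suc (suc (suc (suc k)))) = refl

Linear Cubic : Poly → Set
Linear p = ∃[ s₀ ] ∃[ s₁ ]
  (p ≈ s₀ ∷ s₁ ∷ []) × (s₁ ^ 4 ≡ # 1)
Cubic p = ∃[ s₀ ] ∃[ s₁ ] ∃[ s₂ ] ∃[ s₃ ]
  (p ≈ s₀ ∷ s₁ ∷ s₂ ∷ s₃ ∷ []) × (s₃ ^ 4 ≡ # 1) × (s₂ ^ 2 ≡ # 3 * s₁ * s₃)

𝒫₅⇒condition : ∀ p → 𝒫₅ p → ∃[ s₀ ] ∃[ s₁ ] ∃[ s₂ ] ∃[ s₃ ]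
  (p ≈ s₀ ∷ s₁ ∷ s₂ ∷ s₃ ∷ []) × Condition s₁ s₂ s₃
𝒫₅⇒condition p (deg<5 , bijective) =
  coeff p 0 , coeff p 1 , coeff p 2 , coeff p 3 ,
  coeff-applyUpTo (coeff p) 4 vanish₄ , proj₂ s₄≡0,condition
  where
  vanish₅ : ∀ k → 5 ℕ.≤ k → coeff p k ≡ # 0
  vanish₅ = degree<⇒coeff≡0 p 5 deg<5

  s₄≡0,condition : (coeff p 4 ≡ # 0) × Condition (coeff p 1) (coeff p 2) (coeff p 3)
  s₄≡0,condition = bijective⇒condition (coeff p 0) (coeff p 1) (coeff p 2) (coeff p 3) (coeff p 4)
    -- `applyUpTo (coeff p) 5` reduces to the five-entry list that the search speaks of.
    (bijective-cong 
      (⟦⟧-cong p (applyUpTo (coeff p) 5) (coeff-applyUpTo (coeff p) 5 vanish₅)) bijective)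

  -- The degree bound works from index 5 on; at index 4 it is bijectivity that forces the zero.
  vanish₄ : ∀ k → 4 ℕ.≤ k → coeff p k ≡ # 0
  vanish₄ k 4≤k with ℕ.m≤n⇒m<n∨m≡n 4≤k
  ... | inj₁ 5≤k  = vanish₅ k 5≤k
  ... | inj₂ refl = proj₁ s₄≡0,condition

condition⇒𝒫₅ : ∀ p s₀ s₁ s₂ s₃ →
  p ≈ s₀ ∷ s₁ ∷ s₂ ∷ s₃ ∷ [] → Condition s₁ s₂ s₃ → 𝒫₅ p
condition⇒𝒫₅ p s₀ s₁ s₂ s₃ p≈cubic condition = 𝒫₅-resp-≈ cubic p (≈-sym p cubic p≈cubic)
  (<₋-trans ℕ.<-trans (degree<length cubic) [ ℕ.n<1+n 4 ] ,
   condition⇒bijective s₀ s₁ s₂ s₃ condition)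
  where
  cubic : Poly
  cubic = s₀ ∷ s₁ ∷ s₂ ∷ s₃ ∷ []

linear⇒𝒫₅,1 : ∀ p → Linear p → (𝒫₅, 1) p
linear⇒𝒫₅,1 p (s₀ , s₁ , p≈linear , s₁⁴≡1) =
  condition⇒𝒫₅ p s₀ s₁ (# 0) (# 0)
    (≈-trans p (s₀ ∷ s₁ ∷ []) (s₀ ∷ s₁ ∷ # 0 ∷ # 0 ∷ []) p≈linear (linear≈cubic s₀ s₁))
    (linear⇒condition s₁ s₁⁴≡1) ,
  trans (degree-cong p (s₀ ∷ s₁ ∷ []) p≈linear) (degree-linear s₀ s₁ s₁⁴≡1)

cubic⇒𝒫₅,3 : ∀ p → Cubic p → (𝒫₅, 3) p
cubic⇒𝒫₅,3 p (s₀ , s₁ , s₂ , s₃ , p≈cubic , s₃⁴≡1 , s₂²≡3s₁s₃) =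
  condition⇒𝒫₅ p s₀ s₁ s₂ s₃ p≈cubic (cubic⇒condition s₁ s₂ s₃ s₃⁴≡1 s₂²≡3s₁s₃) ,
  trans (degree-cong p (s₀ ∷ s₁ ∷ s₂ ∷ s₃ ∷ []) p≈cubic) (degree-cubic s₀ s₁ s₂ s₃ s₃⁴≡1)

𝒫₅⇒linear⊎cubic : ∀ p → 𝒫₅ p → Linear p ⊎ Cubic p
𝒫₅⇒linear⊎cubic p p∈𝒫₅ =
  let (s₀ , s₁ , s₂ , s₃ , p≈cubic , condition) = 𝒫₅⇒condition p p∈𝒫₅ in
  Sum.map
    (λ (s₃≡0 , s₂≡0 , s₁⁴≡1) → s₀ , s₁ ,
      ≈-trans p (s₀ ∷ s₁ ∷ # 0 ∷ # 0 ∷ []) (s₀ ∷ s₁ ∷ [])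
        (subst₂ (λ s₂ s₃ → p ≈ s₀ ∷ s₁ ∷ s₂ ∷ s₃ ∷ []) s₂≡0 s₃≡0 p≈cubic)
        (≈-sym (s₀ ∷ s₁ ∷ []) (s₀ ∷ s₁ ∷ # 0 ∷ # 0 ∷ []) (linear≈cubic s₀ s₁)) ,
      s₁⁴≡1)
    (λ s₃⁴≡1 → s₀ , s₁ , s₂ , s₃ , p≈cubic , s₃⁴≡1 , proj₂ condition)
    (condition⇒linear⊎cubic s₁ s₂ s₃ condition)

𝒫₅,1⊥𝒫₅,3 : (𝒫₅, 1) ⊥ (𝒫₅, 3)
𝒫₅,1⊥𝒫₅,3 ((_ , deg≡1) , (_ , deg≡3)) with trans (sym deg≡1) deg≡3
... | ()

-- By exclusion: the cubic shape would put `p` in degree 3 as well. The degree 3 case below is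
-- symmetric.
𝒫₅,1⇒linear : ∀ p → (𝒫₅, 1) p → Linear p
𝒫₅,1⇒linear p p∈@(p∈𝒫₅ , _) = Sum.fromInj₁
  (λ cubic → contradiction (p∈ , cubic⇒𝒫₅,3 p cubic) (𝒫₅,1⊥𝒫₅,3 {p}))
  (𝒫₅⇒linear⊎cubic p p∈𝒫₅)

𝒫₅,3⇒cubic : ∀ p → (𝒫₅, 3) p → Cubic p
𝒫₅,3⇒cubic p p∈@(p∈𝒫₅ , _) = Sum.fromInj₂
  (λ linear → contradiction (linear⇒𝒫₅,1 p linear , p∈) (𝒫₅,1⊥𝒫₅,3 {p}))
  (𝒫₅⇒linear⊎cubic p p∈𝒫₅)

proposition3p2 : (𝒫₅ ≐ (𝒫₅, 1) ∪ (𝒫₅, 3)) × ((𝒫₅, 1) ⊥ (𝒫₅, 3)) ×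
    (𝒫₅ ≐ λ p → ∃[ s₀ ] ∃[ s₁ ] ∃[ s₂ ] ∃[ s₃ ]
    (p ≈ s₀ ∷ s₁ ∷ s₂ ∷ s₃ ∷ []) × ((s₁ + s₃) ^ 4 ≡ # 1) × (s₂ ^ 2 ≡ # 3 * s₁ * s₃)) ×
    ((𝒫₅, 1) ≐ λ p → ∃[ s₀ ] ∃[ s₁ ]
    (p ≈ s₀ ∷ s₁ ∷ []) × (s₁ ^ 4 ≡ # 1)) ×
    ((𝒫₅, 3) ≐ λ p → ∃[ s₀ ] ∃[ s₁ ] ∃[ s₂ ] ∃[ s₃ ]
    (p ≈ s₀ ∷ s₁ ∷ s₂ ∷ s₃ ∷ []) × (s₃ ^ 4 ≡ # 1) × (s₂ ^ 2 ≡ # 3 * s₁ * s₃))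
proposition3p2 =
  ((λ {p} p∈𝒫₅ → Sum.map (linear⇒𝒫₅,1 p) (cubic⇒𝒫₅,3 p) (𝒫₅⇒linear⊎cubic p p∈𝒫₅)) ,
   Sum.[ proj₁ , proj₁ ]) ,
  (λ {p} → 𝒫₅,1⊥𝒫₅,3 {p}) ,
  ((λ {p} → 𝒫₅⇒condition p) ,
   λ {p} (s₀ , s₁ , s₂ , s₃ , p≈cubic , condition) →
     condition⇒𝒫₅ p s₀ s₁ s₂ s₃ p≈cubic condition) ,
  ((λ {p} → 𝒫₅,1⇒linear p) , λ {p} → linear⇒𝒫₅,1 p) ,
  ((λ {p} → 𝒫₅,3⇒cubic p) , λ {p} → cubic⇒𝒫₅,3 p)
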